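{- Every minimally $\gamma_g$-imperfect graph $G$ satisfies $\gamma(G)=2$.
   Context: Graphs are finite, simple, undirected, with at least one vertex, not necessarily connected. $\gamma(G)$ is the domination number of $G$. Domination game on $G$: Dominator and Staller alternately select vertices; each selected vertex must dominate (i.e. contain in its closed neighborhood) at least one vertex not dominated by the previously selected vertices. The game ends when no legal move exists. Dominator wants to minimize and Staller to maximize the total number of moves. $\gamma_g(G)$ is the number of moves under optimal play when Dominator starts. $G$ is $\gamma_g$-perfect if every induced subgraph $F$ of $G$ satisfies $\gamma_g(F)=\gamma(F)$. $G$ is minimally $\gamma_g$-imperfect if each of its proper induced subgraphs is $\gamma_g$-perfect but $\gamma(G)<\gamma_g(G)$. -}

module Defs where

open import Level using (0ℓ)
open import Data.Nat using (ℕ; suc; _≤_; _<_; NonZero)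
open import Data.Nat.Properties using (≤-refl; ≤-trans; ≤-antisym; ≤-total; ≮⇒≥; _<?_)
open import Data.Nat.Induction using (<-wellFounded)
open import Data.Fin using (Fin; zero; suc; _≟_)
open import Data.Fin.Properties using (any?; all?)
open import Data.Fin.Subset using (Subset; _∈_; _∪_; _⊃_; ⁅_⁆; ∣_∣; ⊤; ⊥)
open import Data.Fin.Subset.Properties
  using (_∈?_; anySubset?; ∈⊤; p⊆p∪q; q⊆p∪q; x∈⁅x⁆)
open import Data.Fin.Subset.Induction using (⊃-wellFounded)
open import Data.Product using (∃; ∃-syntax; _×_; _,_; proj₁; proj₂)
open import Data.Sum using (_⊎_; inj₁; inj₂)
open import Function using (_∘_)
open import Function.Bundles using (_↣_; Injection)
open import Induction.WellFounded using (Acc; acc)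
open import Relation.Binary using (Rel; Symmetric; Irreflexive; Decidable)
open import Relation.Binary.PropositionalEquality using (_≡_; refl; cong)
open import Relation.Nullary using (¬_; Dec; yes; no; ¬?; _×-dec_; _⊎-dec_)
open import Relation.Nullary.Negation using (contradiction)
import Relation.Unary as Unary

-- A finite simple graph with vertex set Fin n.  The null graph (n = 0) is
-- excluded by the NonZero hypotheses below, not here.
record Graph (n : ℕ) : Set₁ where
  infix 4 _~_ _~?_
  field
    _~_      : Rel (Fin n) 0ℓ
    _~?_     : Decidable _~_
    ~-sym    : Symmetric _~_
    ~-irrefl : Irreflexive _≡_ _~_

-- The subgraph of G induced by the image of an embedding f, with its vertices
-- named by Fin k via f.  Every induced subgraph arises this way, and it is
-- proper exactly when k < n.
induced : ∀ {k n} → Graph n → Fin k ↣ Fin n → Graph k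
induced G f = record
  { _~_      = λ u v → to u ~ to v
  ; _~?_     = λ u v → to u ~? to v
  ; ~-sym    = ~-sym
  ; ~-irrefl = λ u≡v → ~-irrefl (cong to u≡v)
  }
  where
  open Graph G
  open Injection f using (to)

data Player : Set where
  dominator staller : Player

opponent : Player → Player
opponent dominator = staller
opponent staller   = dominator

-- Prefers p a b : player p likes a remaining game of length a at least as much
-- as one of length b.
Prefers : Player → ℕ → ℕ → Set
Prefers dominator a b = a ≤ b
Prefers staller   a b = b ≤ a

module _ {n : ℕ} (G : Graph n) where
  open Graph G

  -- u lies in the closed neighbourhood of v.
  _∈N[_] : Fin n → Fin n → Set
  u ∈N[ v ] = u ≡ v ⊎ v ~ u

  DominatedBy : Subset n → Fin n → Set
  DominatedBy S u = ∃[ v ] v ∈ S × u ∈N[ v ]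

  Dominating : Subset n → Set
  Dominating S = ∀ u → DominatedBy S u

  IsDominationNumber : ℕ → Set
  IsDominationNumber k =
    (∃[ S ] Dominating S × ∣ S ∣ ≡ k) × (∀ S → Dominating S → k ≤ ∣ S ∣)

  -- The state of the domination game is the set S of vertices selected so far.
  Legal : Subset n → Fin n → Set
  Legal S v = ∃[ u ] u ∈N[ v ] × ¬ DominatedBy S u

  -- GameValue p S k : under optimal play from state S with player p to move,
  -- exactly k further moves are made.  In `move`, f assigns to every legal move
  -- the value of the position it leads to, and v is an optimal legal move.
  data GameValue : Player → Subset n → ℕ → Set where
    over : ∀ {p S} → (∀ v → ¬ Legal S v) → GameValue p S 0
    move : ∀ {p S} (f : Fin n → ℕ) →
           (∀ v → Legal S v → GameValue (opponent p) (S ∪ ⁅ v ⁆) (f v)) →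
           ∀ v → Legal S v → (∀ w → Legal S w → Prefers p (f v) (f w)) →
           GameValue p S (suc (f v))

  IsGameDominationNumber : ℕ → Set
  IsGameDominationNumber = GameValue dominator ⊥

private
  Prefers-refl : ∀ p {a} → Prefers p a a
  Prefers-refl dominator = ≤-refl
  Prefers-refl staller   = ≤-refl

  Prefers-trans : ∀ p {a b c} → Prefers p a b → Prefers p b c → Prefers p a c
  Prefers-trans dominator x y = ≤-trans x y
  Prefers-trans staller   x y = ≤-trans y x

  Prefers-antisym : ∀ p {a b} → Prefers p a b → Prefers p b a → a ≡ b
  Prefers-antisym dominator x y = ≤-antisym x y
  Prefers-antisym staller   x y = ≤-antisym y x

  Prefers-total : ∀ p a b → Prefers p a b ⊎ Prefers p b a
  Prefers-total dominator a b = ≤-total a b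
  Prefers-total staller   a b = ≤-total b a

  best : ∀ p {n} {P : Fin n → Set} → Unary.Decidable P → (f : Fin n → ℕ) → ∃ P →
         ∃[ v ] P v × (∀ w → P w → Prefers p (f v) (f w))
  best p {suc n} {P} P? f (x , px) with any? (P? ∘ suc) | P? zero
  best p {suc n} {P} P? f (zero , px)  | no ¬tail | no ¬p0 = contradiction px ¬p0
  best p {suc n} {P} P? f (suc x , px) | no ¬tail | no _ = contradiction (x , px) ¬tail
  ... | no ¬tail | yes p0 = zero , p0 , λ where
    zero    _  → Prefers-refl p
    (suc w) pw → contradiction (w , pw) ¬tail
  ... | yes tail | P0? with best p (P? ∘ suc) (f ∘ suc) tail
  ...   | v , pv , v-best with P0?
  ...     | no ¬p0 = suc v , pv , λ where
    zero    p0 → contradiction p0 ¬p0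
    (suc w) pw → v-best w pw
  ...     | yes p0 with Prefers-total p (f zero) (f (suc v))
  ...       | inj₁ z≼v = zero , p0 , λ where
    zero    _  → Prefers-refl p
    (suc w) pw → Prefers-trans p z≼v (v-best w pw)
  ...       | inj₂ v≼z = suc v , pv , λ where
    zero    _  → v≼z
    (suc w) pw → v-best w pw

module _ {n : ℕ} (G : Graph n) where
  open Graph G

  dominatedBy? : ∀ S → Unary.Decidable (DominatedBy G S)
  dominatedBy? S u = any? λ v → (v ∈? S) ×-dec ((u ≟ v) ⊎-dec (v ~? u))

  dominating? : Unary.Decidable (Dominating G)
  dominating? S = all? (dominatedBy? S)

  legal? : ∀ S → Unary.Decidable (Legal G S)
  legal? S v = any? λ u → ((u ≟ v) ⊎-dec (v ~? u)) ×-dec ¬? (dominatedBy? S u)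

  dominationNumber-exists : ∃ (IsDominationNumber G)
  dominationNumber-exists =
    shrink ⊤ (λ u → u , ∈⊤ , inj₁ refl) (<-wellFounded _)
    where
    shrink : ∀ S → Dominating G S → Acc _<_ ∣ S ∣ → ∃ (IsDominationNumber G)
    shrink S dom (acc rs) with anySubset? (λ T → dominating? T ×-dec (∣ T ∣ <? ∣ S ∣))
    ... | yes (T , domT , T<S) = shrink T domT (rs T<S)
    ... | no ¬smaller =
      ∣ S ∣ , (S , dom , refl) , λ T domT → ≮⇒≥ λ T<S → ¬smaller (T , domT , T<S)

  dominationNumber-unique : ∀ {j k} →
    IsDominationNumber G j → IsDominationNumber G k → j ≡ k
  dominationNumber-unique ((S , domS , refl) , minS) ((T , domT , refl) , minT) =
    ≤-antisym (minS T domT) (minT S domS)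

  gameValue-exists : ∀ p S → ∃ (GameValue G p S)
  gameValue-exists p S = go p S (⊃-wellFounded S)
    where
    grows : ∀ {S v} → Legal G S v → (S ∪ ⁅ v ⁆) ⊃ S
    grows {S} {v} (u , u∈N , ¬dom) =
      p⊆p∪q ⁅ v ⁆ , v , q⊆p∪q S ⁅ v ⁆ (x∈⁅x⁆ v) , λ v∈S → ¬dom (v , v∈S , u∈N)

    go : ∀ p S → Acc _⊃_ S → ∃ (GameValue G p S)
    go p S (acc rs) with any? (legal? S)
    ... | no ¬legal = 0 , over λ v l → ¬legal (v , l)
    ... | yes legal = suc (f v) , move f f-value v lv v-best
      where
      f′ : ∀ v → Dec (Legal G S v) → ℕ
      f′ v (yes l) = proj₁ (go (opponent p) (S ∪ ⁅ v ⁆) (rs (grows l)))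
      f′ v (no _)  = 0

      f : Fin n → ℕ
      f v = f′ v (legal? S v)

      f-value : ∀ v → Legal G S v → GameValue G (opponent p) (S ∪ ⁅ v ⁆) (f v)
      f-value v l with legal? S v
      ... | yes l′ = proj₂ (go (opponent p) (S ∪ ⁅ v ⁆) (rs (grows l′)))
      ... | no ¬l  = contradiction l ¬l

      optimal = best p (legal? S) f legal
      v       = proj₁ optimal
      lv      = proj₁ (proj₂ optimal)
      v-best  = proj₂ (proj₂ optimal)

  gameValue-unique : ∀ {p S j k} → GameValue G p S j → GameValue G p S k → j ≡ k
  gameValue-unique (over _) (over _) = refl
  gameValue-unique (over ¬l) (move _ _ v l _) = contradiction l (¬l v)
  gameValue-unique (move _ _ v l _) (over ¬l) = contradiction l (¬l v)
  gameValue-unique {p} (move f fv v lv bv) (move g gw w lw bw) =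
    cong suc (Prefers-antisym p v≼w w≼v)
    where
    v≼w : Prefers p (f v) (g w)
    v≼w rewrite gameValue-unique (gw w lw) (fv w lw) = bv w lw
    w≼v : Prefers p (g w) (f v)
    w≼v rewrite gameValue-unique (fv v lv) (gw v lv) = bw v lv

  γ : ℕ
  γ = proj₁ dominationNumber-exists

  γ-correct : IsDominationNumber G γ
  γ-correct = proj₂ dominationNumber-exists

  γg : ℕ
  γg = proj₁ (gameValue-exists dominator ⊥)

  γg-correct : IsGameDominationNumber G γg
  γg-correct = proj₂ (gameValue-exists dominator ⊥)

Perfect : ∀ {n} → Graph n → Set
Perfect {n} G = ∀ k → .{{NonZero k}} → (f : Fin k ↣ Fin n) →
                γg (induced G f) ≡ γ (induced G f)

MinimallyImperfect : ∀ {n} → Graph n → Set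
MinimallyImperfect {n} G =
  (∀ k → .{{NonZero k}} → (f : Fin k ↣ Fin n) → k < n → Perfect (induced G f))
  × γ G < γg G

{-# OPTIONS --safe #-}

-- Write N[v] for closed neighbourhoods.  If γ(G) ≠ 2, minimality gives: every set P
-- of vertices dominated by two of its members has a member v whose non-neighbours in P
-- are twins in P (the pair condition), for otherwise Staller forces a third move.
-- Hence some v is good: adjacent non-neighbours of v have equal closed neighbourhoods.
-- Choose such a v for which V ∖ N[v] meets the fewest twin classes, say m.  Then
-- m < γ(G): if a vertex sees two of these classes, or if each vertex of a minimum
-- dominating set is used up by one class, the pair condition yields a good vertex
-- missing fewer classes.  After Dominator opens with v, each move newly dominates a
-- whole class, so γ_g(G) ≤ 1 + m ≤ γ(G), contrary to imperfection.
module Submission where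

open import Defs
open import Level using (0ℓ)
open import Data.Empty using (⊥)
open import Data.Nat using (ℕ; zero; suc; _≤_; _<_; z≤n; s≤s; NonZero)
open import Data.Nat.Properties as ℕ using (≤-trans; ≤-<-trans; ≮⇒≥; <⇒≱; _<?_)
open import Data.Nat.Induction using (<-wellFounded)
open import Data.Fin as Fin using (Fin; zero; suc; toℕ; _≟_)
open import Data.Fin.Patterns
open import Data.Fin.Properties using (any?; all?; <-cmp; suc-injective; 0≢1+n)
open import Data.Fin.Subset using (Subset; inside; outside; _∈_; _-_; _∪_; ⁅_⁆; ∣_∣; ⊤)
  renaming (⊥ to ∅)
open import Data.Fin.Subset.Properties
  using (_∈?_; x∈p∧x≢y⇒x∈p-y; x∈p⇒∣p-x∣<∣p∣; x∈p∪q⁻; x∈p∪q⁺; x∈⁅x⁆; x∈⁅y⁆⇒x≡y; ∈⊤; ∉⊥; ∣⊤∣≡n)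
open import Data.Product using (∃; _×_; _,_; proj₁; proj₂)
open import Data.Sum using (_⊎_; inj₁; inj₂)
open import Data.Unit using (tt)
open import Data.Vec using (Vec; []; _∷_; here; there; tabulate; lookup)
open import Data.Vec.Properties using (lookup∘tabulate; []=⇒lookup; lookup⇒[]=)
open import Function using (_∘_; id)
open import Function.Bundles using (mk↣)
open import Induction.WellFounded using (Acc; acc)
open import Relation.Binary using (Rel; tri<; tri≈; tri>)
import Relation.Binary as Binary
open import Relation.Binary.PropositionalEquality
  using (_≡_; _≢_; refl; sym; trans; cong; subst)
open import Relation.Nullary using (¬_; Dec; yes; no; does; ¬?; _×-dec_; _⊎-dec_; _→-dec_)
open import Relation.Nullary.Decidable using (map′; decidable-stable; dec-true)
open import Relation.Nullary.Negation using (contradiction)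
open import Relation.Unary using (Pred; Decidable; U)

-- Extremal choice and counting in finite sets.

minimise : {A : Set} (f : A → ℕ) → (∀ a → Dec (∃ λ b → f b < f a)) →
           A → ∃ λ a → ∀ b → f a ≤ f b
minimise {A} f smaller? a₀ = go a₀ (<-wellFounded _)
  where
  go : ∀ a → Acc _<_ (f a) → ∃ λ a → ∀ b → f a ≤ f b
  go a (acc rs) with smaller? a
  ... | yes (b , b<a) = go b (rs b<a)
  ... | no none       = a , λ b → ≮⇒≥ λ b<a → none (b , b<a)

-- Each member of `p` strikes its image from `q`. Injectivity is asked for on `p` only, because the
-- maps used below merge vertices outside it.
injective⇒∣p∣≤∣q∣ : ∀ {m n} (p : Subset m) (q : Subset n) (f : Fin m → Fin n) →
  (∀ {x} → x ∈ p → f x ∈ q) →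
  (∀ {x y} → x ∈ p → y ∈ p → f x ≡ f y → x ≡ y) →
  ∣ p ∣ ≤ ∣ q ∣
injective⇒∣p∣≤∣q∣ []            q f into inj = z≤n
injective⇒∣p∣≤∣q∣ (outside ∷ p) q f into inj =
  injective⇒∣p∣≤∣q∣ p q (f ∘ suc) (into ∘ there)
    λ x∈ y∈ eq → suc-injective (inj (there x∈) (there y∈) eq)
injective⇒∣p∣≤∣q∣ (inside ∷ p) q f into inj = ≤-<-trans
  (injective⇒∣p∣≤∣q∣ p (q - f zero) (f ∘ suc)
    (λ x∈ → x∈p∧x≢y⇒x∈p-y (into (there x∈)) λ eq → 0≢1+n (sym (inj (there x∈) here eq)))
    λ x∈ y∈ eq → suc-injective (inj (there x∈) (there y∈) eq))
  (x∈p⇒∣p-x∣<∣p∣ (into here))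

injective⇒∣p∣<∣q∣ : ∀ {m n} (p : Subset m) (q : Subset n) (f : Fin m → Fin n) →
  (∀ {x} → x ∈ p → f x ∈ q) →
  (∀ {x y} → x ∈ p → y ∈ p → f x ≡ f y → x ≡ y) →
  ∀ {z} → z ∈ q → (∀ {x} → x ∈ p → f x ≢ z) →
  ∣ p ∣ < ∣ q ∣
injective⇒∣p∣<∣q∣ p q f into inj z∈q avoids = ≤-<-trans
  (injective⇒∣p∣≤∣q∣ p (q - _) f (λ x∈ → x∈p∧x≢y⇒x∈p-y (into x∈) (avoids x∈)) inj)
  (x∈p⇒∣p-x∣<∣p∣ z∈q)

module _ {n : ℕ} {P : Pred (Fin n) 0ℓ} (P? : Decidable P) where

  comprehension : Subset n
  comprehension = tabulate (does ∘ P?)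

  ∈-comprehension⁺ : ∀ {x} → P x → x ∈ comprehension
  ∈-comprehension⁺ {x} px =
    lookup⇒[]= x _ (trans (lookup∘tabulate _ x) (dec-true (P? x) px))

  ∈-comprehension⁻ : ∀ {x} → x ∈ comprehension → P x
  ∈-comprehension⁻ {x} x∈ with P? x | trans (sym (lookup∘tabulate (does ∘ P?) x)) ([]=⇒lookup x∈)
  ... | yes px | _ = px
  ... | no _   | ()

  size : ℕ
  size = ∣ comprehension ∣

size-< : ∀ {n} {P Q : Pred (Fin n) 0ℓ} (P? : Decidable P) (Q? : Decidable Q) →
         (∀ {x} → P x → Q x) → ∀ {z} → Q z → ¬ P z → size P? < size Q?
size-< P? Q? P⊆Q qz ¬pz = injective⇒∣p∣<∣q∣ _ _ id
  (∈-comprehension⁺ Q? ∘ P⊆Q ∘ ∈-comprehension⁻ P?) (λ _ _ eq → eq)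
  (∈-comprehension⁺ Q? qz) λ { x∈ refl → ¬pz (∈-comprehension⁻ P? x∈) }

-- Twins, good vertices and missed twin classes.

module ClosedNeighbourhoods
  {n : ℕ} (_—_ : Rel (Fin n) 0ℓ) (_—?_ : Binary.Decidable _—_)
  (—-refl : ∀ {u} → u — u) (—-sym : ∀ {u v} → u — v → v — u)
  where

  -- If Dominator opens with `v` in the subgraph induced by `P`, any reply ends the game: whatever
  -- dominates one remaining vertex dominates all of them.
  TwinsBeyond : Pred (Fin n) 0ℓ → Pred (Fin n) 0ℓ
  TwinsBeyond P v = ∀ {x y z} → P x → P y → P z →
                    ¬ x — v → ¬ y — v → z — x → z — y

  -- Only adjacent `x` and `y` are compared, so each component of `P` outside N[v] is a clique of
  -- twins in `P`.
  CliquesBeyond : Pred (Fin n) 0ℓ → Pred (Fin n) 0ℓ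
  CliquesBeyond P v = ∀ {x y z} → P x → P y → P z →
                      ¬ x — v → ¬ y — v → x — y → z — x → z — y

  -- This is what γ_g ≤ 2 gives for an induced subgraph that two vertices, possibly equal, dominate.
  PairCondition : Set₁
  PairCondition = ∀ {P : Pred (Fin n) 0ℓ} → Decidable P → ∀ {a b} → P a → P b →
                  (∀ {u} → P u → u — a ⊎ u — b) → ∃ λ v → P v × TwinsBeyond P v

  Twin : Rel (Fin n) 0ℓ
  Twin u w = ∀ z → (z — u → z — w) × (z — w → z — u)

  twin? : Binary.Decidable Twin
  twin? u w = all? λ z → ((z —? u) →-dec (z —? w)) ×-dec ((z —? w) →-dec (z —? u))

  -- The vertex with the smallest name represents its class of twins.
  Representative : Pred (Fin n) 0ℓ
  Representative u = ∀ w → w Fin.< u → ¬ Twin w u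

  representative? : Decidable Representative
  representative? u = all? λ w → (w Fin.<? u) →-dec ¬? (twin? w u)

  representative-exists : ∀ u → ∃ λ r → Representative r × Twin r u
  representative-exists u with minimise {∃ λ r → Twin r u} (toℕ ∘ proj₁)
    (λ _ → map′ (λ (r , tw , lt) → (r , tw) , lt) (λ ((r , tw) , lt) → r , tw , lt)
             (any? λ r → twin? r u ×-dec (_ <? _)))
    (u , λ _ → id , id)
  ... | (r , r~u) , least = r , (λ w w<r w~r → <⇒≱ w<r (least (w , λ z →
          proj₁ (r~u z) ∘ proj₁ (w~r z) , proj₂ (w~r z) ∘ proj₂ (r~u z)))) , r~u

  representative-unique : ∀ {r s} → Representative r → Representative s → Twin r s → r ≡ s
  representative-unique {r} {s} Rr Rs r~s with <-cmp r s
  ... | tri< r<s _ _ = contradiction r~s (Rs r r<s)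
  ... | tri≈ _ eq _  = eq
  ... | tri> _ _ s<r = contradiction (λ z → proj₂ (r~s z) , proj₁ (r~s z)) (Rr s s<r)

  Good : Pred (Fin n) 0ℓ
  Good v = ∀ x y z → ¬ x — v → ¬ y — v → x — y → z — x → z — y

  good? : Decidable Good
  good? v = all? λ x → all? λ y → all? λ z →
    ¬? (x —? v) →-dec ¬? (y —? v) →-dec (x —? y) →-dec (z —? x) →-dec (z —? y)

  -- Twins lie in N[v] together, so counting these representatives counts the twin classes that `v`
  -- leaves undominated.
  Missed : Fin n → Pred (Fin n) 0ℓ
  Missed v u = Representative u × ¬ u — v

  missed? : ∀ v → Decidable (Missed v)
  missed? v u = representative? u ×-dec ¬? (u —? v)

  -- Consequences of the pair condition: forbidden subgraphs and a good vertex.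

  module _ (pair : PairCondition) where

    Listed : ∀ {k} → Vec (Fin n) k → Pred (Fin n) 0ℓ
    Listed xs u = ∃ λ i → lookup xs i ≡ u

    listed? : ∀ {k} (xs : Vec (Fin n) k) → Decidable (Listed xs)
    listed? xs u = any? λ i → lookup xs i ≟ u

    -- Each vertex of the path misses two vertices told apart by the path.
    no-P₅ : ∀ {a b c d e} → a — b → b — c → c — d → d — e →
            ¬ a — c → ¬ a — d → ¬ a — e → ¬ b — d → ¬ b — e → ¬ c — e → ⊥
    no-P₅ {a} {b} {c} {d} {e} ab bc cd de ¬ac ¬ad ¬ae ¬bd ¬be ¬ce
      with pair (listed? (a ∷ b ∷ c ∷ d ∷ e ∷ [])) (1F , refl) (3F , refl)
             (λ { (0F , refl) → inj₁ ab ; (1F , refl) → inj₁ —-refl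
                ; (2F , refl) → inj₁ (—-sym bc) ; (3F , refl) → inj₂ —-refl
                ; (4F , refl) → inj₂ (—-sym de) })
    ... | _ , (0F , refl) , tw =
      ¬ce (tw (2F , refl) (4F , refl) (2F , refl) (¬ac ∘ —-sym) (¬ae ∘ —-sym) —-refl)
    ... | _ , (1F , refl) , tw =
      ¬ce (tw (3F , refl) (4F , refl) (2F , refl) (¬bd ∘ —-sym) (¬be ∘ —-sym) cd)
    ... | _ , (2F , refl) , tw =
      ¬ae (tw (0F , refl) (4F , refl) (0F , refl) ¬ac (¬ce ∘ —-sym) —-refl)
    ... | _ , (3F , refl) , tw =
      ¬ac (—-sym (tw (1F , refl) (0F , refl) (2F , refl) ¬bd ¬ad (—-sym bc)))
    ... | _ , (4F , refl) , tw =
      ¬ac (tw (0F , refl) (2F , refl) (0F , refl) ¬ae ¬ce —-refl)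

    -- While `d` and `e` dominate all seven vertices, each of the seven misses two that another
    -- tells apart. For `x` these are `d` and one of `q`, `r`, told apart by `v`; for `y` they are
    -- `e` and one of `q`, `r`.
    no-double-net : ∀ {v d e q r x y} →
      v — d → v — e → d — q → e — r → v — x → v — y → e — x → d — y →
      ¬ v — q → ¬ v — r → ¬ d — r → ¬ e — q → ¬ d — x → ¬ e — y → ¬ q — r →
      d — e → ¬ (q — x × r — x) → ¬ (q — y × r — y) → ⊥
    no-double-net {v} {d} {e} {q} {r} {x} {y}
      vd ve dq er vx vy ex dy ¬vq ¬vr ¬dr ¬eq ¬dx ¬ey ¬qr de ¬qrx ¬qry
      with pair (listed? (v ∷ d ∷ e ∷ q ∷ r ∷ x ∷ y ∷ [])) (1F , refl) (2F , refl)
             (λ { (0F , refl) → inj₁ vd ; (1F , refl) → inj₁ —-refl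
                ; (2F , refl) → inj₂ —-refl ; (3F , refl) → inj₁ (—-sym dq)
                ; (4F , refl) → inj₂ (—-sym er) ; (5F , refl) → inj₂ (—-sym ex)
                ; (6F , refl) → inj₁ (—-sym dy) })
    ... | _ , (0F , refl) , tw =
      ¬qr (tw (3F , refl) (4F , refl) (3F , refl) (¬vq ∘ —-sym) (¬vr ∘ —-sym) —-refl)
    ... | _ , (1F , refl) , tw =
      ¬vr (tw (5F , refl) (4F , refl) (0F , refl) (¬dx ∘ —-sym) (¬dr ∘ —-sym) vx)
    ... | _ , (2F , refl) , tw =
      ¬vq (tw (6F , refl) (3F , refl) (0F , refl) (¬ey ∘ —-sym) (¬eq ∘ —-sym) vy)
    ... | _ , (3F , refl) , tw =
      ¬vr (—-sym (tw (2F , refl) (0F , refl) (4F , refl) ¬eq ¬vq (—-sym er)))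
    ... | _ , (4F , refl) , tw =
      ¬vq (—-sym (tw (1F , refl) (0F , refl) (3F , refl) ¬dr ¬vr (—-sym dq)))
    ... | _ , (5F , refl) , tw with q —? x
    ...   | no ¬qx = ¬vq (tw (1F , refl) (3F , refl) (0F , refl) ¬dx ¬qx vd)
    ...   | yes qx = ¬vr (tw (1F , refl) (4F , refl) (0F , refl) ¬dx (λ rx → ¬qrx (qx , rx)) vd)
    no-double-net {v} {d} {e} {q} {r} {x} {y}
      vd ve dq er vx vy ex dy ¬vq ¬vr ¬dr ¬eq ¬dx ¬ey ¬qr de ¬qrx ¬qry
        | _ , (6F , refl) , tw with q —? y
    ...   | no ¬qy = ¬vq (tw (2F , refl) (3F , refl) (0F , refl) ¬ey ¬qy ve)
    ...   | yes qy = ¬vr (tw (2F , refl) (4F , refl) (0F , refl) ¬ey (λ ry → ¬qry (qy , ry)) ve)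

    -- F is a part of P dominated by two vertices of P, and largest such; it consists of
    -- N[v] and of a set Q of twins, which by maximality are twins in P.  If v′ works for
    -- P ∖ Q but not for P, then v works for P.
    module MaximalPair
      {P : Pred (Fin n) 0ℓ} (P? : Decidable P)
      {F : Pred (Fin n) 0ℓ} (F? : Decidable F) (F⇒P : ∀ {u} → F u → P u)
      (F-maximal : ∀ {a b} → P a → P b → (∀ {u} → F u → u — a ⊎ u — b) →
                   ∀ {u} → P u → u — a ⊎ u — b → F u)
      {v : Fin n} (Pv : P v) (F-twins : TwinsBeyond F v)
      {w₀ : Fin n} (Pw₀ : P w₀) (¬Fw₀ : ¬ F w₀)
      where

      Q : Pred (Fin n) 0ℓ
      Q u = F u × ¬ u — v

      Q? : Decidable Q
      Q? u = F? u ×-dec ¬? (u —? v)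

      F⊆N∪Q : ∀ {u} → F u → u — v ⊎ Q u
      F⊆N∪Q {u} Fu with u —? v
      ... | yes uv = inj₁ uv
      ... | no ¬uv = inj₂ (Fu , ¬uv)

      Q-clique : ∀ {q q′} → Q q → Q q′ → q — q′
      Q-clique (Fq , q∉) (Fq′ , q′∉) = F-twins Fq Fq′ Fq q∉ q′∉ —-refl

      F⊆N[v]∪N[_] : ∀ {q} → Q q → ∀ {u} → F u → u — v ⊎ u — q
      F⊆N[v]∪N[_] Qq Fu with F⊆N∪Q Fu
      ... | inj₁ uv = inj₁ uv
      ... | inj₂ Qu = inj₂ (Q-clique Qu Qq)

      -- With `Q` empty, `v` alone would dominate `F`, and `v` with `w₀` would dominate more than
      -- the maximal `F`.
      q₀-exists : ∃ Q
      q₀-exists = decidable-stable (any? Q?) λ none → ¬Fw₀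
        (F-maximal Pv Pw₀
          (λ Fu → inj₁ (decidable-stable (_ —? v) λ u∉ → none (_ , Fu , u∉)))
          Pw₀ (inj₂ —-refl))
      q₀ = proj₁ q₀-exists
      Qq₀ = proj₂ q₀-exists

      N[v]⊆F : ∀ {u} → P u → u — v → F u
      N[v]⊆F pu uv = F-maximal Pv (F⇒P (proj₁ Qq₀)) F⊆N[v]∪N[ Qq₀ ] pu (inj₁ uv)

      N[q]⊆F : ∀ {q u} → Q q → P u → u — q → F u
      N[q]⊆F Qq pu uq =
        F-maximal Pv (F⇒P (proj₁ Qq)) F⊆N[v]∪N[ Qq ] pu (inj₂ uq)

      Q-twins : ∀ {q q′ z} → Q q → Q q′ → P z → z — q → z — q′
      Q-twins Qq@(Fq , q∉) (Fq′ , q′∉) pz zq =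
        F-twins Fq Fq′ (N[q]⊆F Qq pz zq) q∉ q′∉ zq

      -- Seeing one of the twins in `Q`, `x` sees them all, so `v` and `x` dominate `F` and, by
      -- maximality, nothing of `P` beyond it.
      N[_,_]⊆F : ∀ {x q} → P x → Q q → x — q → ∀ {u} → P u → u — x → F u
      N[_,_]⊆F {x} px Qq xq pu ux = F-maximal Pv px cover pu (inj₂ ux)
        where
        cover : ∀ {f} → F f → f — v ⊎ f — x
        cover Ff with F⊆N∪Q Ff
        ... | inj₁ fv = inj₁ fv
        ... | inj₂ Qf = inj₂ (—-sym (Q-twins Qq Qf px xq))

      F⊈N[_] : ∀ {x} → P x → ¬ (∀ {f} → F f → f — x)
      F⊈N[ px ] F⊆ = ¬Fw₀ (F-maximal px Pw₀ (inj₁ ∘ F⊆) Pw₀ (inj₂ —-refl))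

      P∖Q : Pred (Fin n) 0ℓ
      P∖Q u = P u × ¬ Q u

      P∖Q? : Decidable P∖Q
      P∖Q? u = P? u ×-dec ¬? (Q? u)

      P∖Q-nonempty : ∃ P∖Q
      P∖Q-nonempty = v , Pv , λ (_ , v∉) → v∉ —-refl

      P∖Q-smaller : size P∖Q? < size P?
      P∖Q-smaller = size-< P∖Q? P? proj₁ (F⇒P (proj₁ Qq₀)) λ (_ , ¬Qq₀) → ¬Qq₀ Qq₀

      module _ {v′} (Pv′ : P v′) (cliques′ : CliquesBeyond P∖Q v′) where

        module _ {c q} (Pc : P c) (cv : c — v) (Qq : Q q) (cq : c — q) (¬cv′ : ¬ c — v′) where

          -- Otherwise `v` and `c` are adjacent vertices of `P∖Q` missed by `v′`, hence twins there.
          -- As `c` also sees all of `Q`, it would dominate `F` by itself.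
          v—v′ : v — v′
          v—v′ = decidable-stable (v —? v′) λ ¬vv′ →
            F⊈N[ Pc ] λ Ff → F⊆N[c] ¬vv′ (F⊆N∪Q Ff) (F⇒P Ff)
            where
            F⊆N[c] : ¬ v — v′ → ∀ {f} → f — v ⊎ Q f → P f → f — c
            F⊆N[c] ¬vv′ (inj₁ fv) Pf =
              cliques′ (Pv , λ (_ , v∉) → v∉ —-refl) (Pc , λ (_ , c∉) → c∉ cv)
                (Pf , λ (_ , f∉) → f∉ fv) ¬vv′ ¬cv′ (—-sym cv) fv
            F⊆N[c] _ (inj₂ Qf) _ = —-sym (Q-twins Qq Qf Pc cq)

          -- If `v′` sees `q`, its neighbours in `P` stay inside `F`. If not, `q`, `c`, `v`, `v′`,
          -- `w` would form an induced path.
          ¬outside—v′ : ∀ {w} → P w → ¬ F w → ¬ w — v′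
          ¬outside—v′ {w} Pw ¬Fw wv′ with v′ —? q
          ... | yes v′q = ¬Fw (N[ Pv′ , Qq ]⊆F v′q Pw wv′)
          ... | no ¬v′q = no-P₅ (—-sym cq) cv v—v′ (—-sym wv′)
            (proj₂ Qq) (¬v′q ∘ —-sym) (λ qw → ¬Fw (N[q]⊆F Qq Pw (—-sym qw)))
            ¬cv′ (λ cw → ¬Fw (N[ Pc , Qq ]⊆F cq Pw (—-sym cw)))
            (λ vw → ¬Fw (N[v]⊆F Pw (—-sym vw)))

          -- Vertices of `P` that see `Q` lie in `F`, so adjacent vertices missed by `v` are both in
          -- `Q` or both outside `F`. In the latter case `v′` misses them too.
          v-works : CliquesBeyond P v
          v-works {x} {y} {z} Px Py Pz x∉ y∉ xy zx with F? x | F? y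
          ... | yes Fx | yes Fy = Q-twins (Fx , x∉) (Fy , y∉) Pz zx
          ... | yes Fx | no ¬Fy = contradiction (N[q]⊆F (Fx , x∉) Py (—-sym xy)) ¬Fy
          ... | no ¬Fx | yes Fy = contradiction (N[q]⊆F (Fy , y∉) Px xy) ¬Fx
          ... | no ¬Fx | no ¬Fy with Q? z
          ...   | yes Qz = contradiction (N[q]⊆F Qz Px (—-sym zx)) ¬Fx
          ...   | no ¬Qz = cliques′ (Px , ¬Fx ∘ proj₁) (Py , ¬Fy ∘ proj₁) (Pz , ¬Qz)
                           (¬outside—v′ Px ¬Fx) (¬outside—v′ Py ¬Fy) xy zx

        -- Such a vertex decides between the two candidates: if one exists then `v` works for `P`,
        -- otherwise `v′` does.
        Link : Pred (Fin n) 0ℓ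
        Link c = P c × c — v × (∃ λ q → Q q × c — q) × ¬ c — v′

        link? : Dec (∃ Link)
        link? = any? λ c → P? c ×-dec (c —? v) ×-dec
                  any? (λ q → Q? q ×-dec (c —? q)) ×-dec ¬? (c —? v′)

        -- Suppose `Q` contains exactly one of `x` and `y`, or only `z`. Then a neighbour of it
        -- among `x`, `y` lies in `F` but not in `Q`, hence in N[v], and is a link.
        v′-works : ¬ ∃ Link → CliquesBeyond P v′
        v′-works ¬link {x} {y} {z} Px Py Pz x∉ y∉ xy zx with Q? x | Q? y
        ... | yes Qx | yes Qy = Q-twins Qx Qy Pz zx
        ... | yes Qx | no ¬Qy with F⊆N∪Q (N[q]⊆F Qx Py (—-sym xy))
        ...   | inj₁ yv = contradiction (y , Py , yv , (x , Qx , —-sym xy) , y∉) ¬link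
        ...   | inj₂ Qy = contradiction Qy ¬Qy
        v′-works ¬link {x} {y} {z} Px Py Pz x∉ y∉ xy zx
            | no ¬Qx | yes Qy with F⊆N∪Q (N[q]⊆F Qy Px xy)
        ...   | inj₁ xv = contradiction (x , Px , xv , (y , Qy , xy) , x∉) ¬link
        ...   | inj₂ Qx = contradiction Qx ¬Qx
        v′-works ¬link {x} {y} {z} Px Py Pz x∉ y∉ xy zx
            | no ¬Qx | no ¬Qy with Q? z
        ... | no ¬Qz = cliques′ (Px , ¬Qx) (Py , ¬Qy) (Pz , ¬Qz) x∉ y∉ xy zx
        ... | yes Qz with F⊆N∪Q (N[q]⊆F Qz Px (—-sym zx))
        ...   | inj₁ xv = contradiction (x , Px , xv , (z , Qz , —-sym zx) , x∉) ¬link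
        ...   | inj₂ Qx = contradiction Qx ¬Qx

        result : ∃ λ v → P v × CliquesBeyond P v
        result with link?
        ... | yes (c , Pc , cv , (q , Qq , cq) , ¬cv′) = v , Pv , v-works Pc cv Qq cq ¬cv′
        ... | no ¬link = v′ , Pv′ , v′-works ¬link

    -- Induction on the size of `P`: either some pair dominates `P` outright, or the nonempty `Q` is
    -- removed and the vertex found for the rest competes with `v`.
    cliquesBeyond-exists : ∀ {P : Pred (Fin n) 0ℓ} → Decidable P → ∃ P →
                           ∃ λ v → P v × CliquesBeyond P v
    cliquesBeyond-exists P? nonempty = go P? nonempty (<-wellFounded _)
      where
      go : ∀ {P : Pred (Fin n) 0ℓ} (P? : Decidable P) → ∃ P → Acc _<_ (size P?) →
           ∃ λ v → P v × CliquesBeyond P v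
      go {P} P? p₀ (acc rs) = fromBest (minimise {∃ P × ∃ P}
        (λ ((a , _) , (b , _)) → size (uncovered? a b))
        (λ _ → map′ (λ (a , pa , b , pb , lt) → ((a , pa) , (b , pb)) , lt)
                    (λ (((a , pa) , (b , pb)) , lt) → a , pa , b , pb , lt)
               (any? λ a → P? a ×-dec any? λ b → P? b ×-dec (_ <? _)))
        (p₀ , p₀))
        where
        uncovered? : ∀ a b → Decidable (λ u → P u × ¬ (u — a ⊎ u — b))
        uncovered? a b u = P? u ×-dec ¬? ((u —? a) ⊎-dec (u —? b))

        fromBest : (∃ λ (ab : ∃ P × ∃ P) → ∀ (cd : ∃ P × ∃ P) →
                    size (uncovered? (proj₁ (proj₁ ab)) (proj₁ (proj₂ ab))) ≤
                    size (uncovered? (proj₁ (proj₁ cd)) (proj₁ (proj₂ cd)))) →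
                   ∃ λ v → P v × CliquesBeyond P v
        fromBest (((a , Pa) , (b , Pb)) , least) =
          split (pair F? (Pa , inj₁ —-refl) (Pb , inj₂ —-refl) proj₂)
          where
          F : Pred (Fin n) 0ℓ
          F u = P u × (u — a ⊎ u — b)

          F? : Decidable F
          F? u = P? u ×-dec ((u —? a) ⊎-dec (u —? b))

          F-maximal : ∀ {c d} → P c → P d → (∀ {u} → F u → u — c ⊎ u — d) →
                      ∀ {u} → P u → u — c ⊎ u — d → F u
          F-maximal {c} {d} Pc Pd F⊆ {u} Pu u∈ = decidable-stable (F? u) λ ¬Fu →
            <⇒≱ (size-< (uncovered? c d) (uncovered? a b)
                   (λ (Px , x∉) → Px , λ x∈ → x∉ (F⊆ (Px , x∈)))
                   (Pu , λ u∈F → ¬Fu (Pu , u∈F)) (λ (_ , u∉) → u∉ u∈))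
                (least ((c , Pc) , (d , Pd)))

          split : (∃ λ v → F v × TwinsBeyond F v) → ∃ λ v → P v × CliquesBeyond P v
          split (v , (Pv , _) , F-twins) with any? (λ w → P? w ×-dec ¬? (F? w))
          ... | no none = v , Pv , λ Px Py Pz x∉ y∉ _ → F-twins (all-F Px) (all-F Py) (all-F Pz) x∉ y∉
            where
            all-F : ∀ {x} → P x → F x
            all-F {x} Px = decidable-stable (F? x) λ ¬Fx → none (x , Px , ¬Fx)
          ... | yes (w₀ , Pw₀ , ¬Fw₀) = extend (go P∖Q? P∖Q-nonempty (rs P∖Q-smaller))
            where
            open MaximalPair P? F? proj₁ F-maximal Pv F-twins Pw₀ ¬Fw₀

            extend : (∃ λ v′ → P∖Q v′ × CliquesBeyond P∖Q v′) → ∃ λ v → P v × CliquesBeyond P v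
            extend (v′ , (Pv′ , _) , cliques′) = result Pv′ cliques′

    -- A good vertex missing the fewest twin classes.

    module LeastMissed
      {v : Fin n} (good : Good v) (least : ∀ w → Good w → size (missed? v) ≤ size (missed? w))
      where

      -- All that `w` misses is missed by `v`, so `w` is good as well, and seeing `q` would make it
      -- a better choice than `v`.
      no-larger : ∀ {w q} → (∀ {u} → u — v → u — w) → Missed v q → ¬ q — w
      no-larger {w} {q} N⊆ Mq qw = <⇒≱
        (size-< (missed? w) (missed? v) (λ (Ru , u∉) → Ru , u∉ ∘ N⊆) Mq λ (_ , q∉) → q∉ qw)
        (least w λ x y z x∉ y∉ → good x y z (x∉ ∘ N⊆) (y∉ ∘ N⊆))

      missed-independent : ∀ {p q} → Missed v p → Missed v q → p — q → p ≡ q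
      missed-independent (Rp , p∉) (Rq , q∉) pq =
        representative-unique Rp Rq λ z → good _ _ z p∉ q∉ pq , good _ _ z q∉ p∉ (—-sym pq)

      module SeesTwo {p q} (Mp : Missed v p) (Mq : Missed v q) (p≢q : p ≢ q) where

        ¬pq : ¬ p — q
        ¬pq = p≢q ∘ missed-independent Mp Mq

        -- Some x sees p and q and an inclusion-maximal part of V ∖ N[v].  The vertex t that
        -- the pair condition provides for N[v] ∪ N[x] is then a better choice than v.
        module Maximal
          {x : Fin n} (px : p — x) (qx : q — x)
          (x-maximal : ∀ {y} → p — y → q — y → (∀ {u} → ¬ u — v → u — x → u — y) →
                       ∀ {u} → ¬ u — v → u — y → u — x)
          {t : Fin n} (tw : TwinsBeyond (λ u → u — v ⊎ u — x) t)
          where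

          -- If `t` missed both `a` and `y`, these would be twins in N[v] ∪ N[x], but `v` sees only
          -- `y`.
          misses-one-side : ∀ {a} → ¬ a — v → a — x → ¬ a — t → ∀ {y} → y — v → y — t
          misses-one-side a∉ ax ¬at {y} yv = decidable-stable (y —? t) λ ¬yt →
            a∉ (—-sym (tw (inj₁ yv) (inj₂ ax) (inj₁ —-refl) ¬yt ¬at (—-sym yv)))

          -- If `t` lay outside N[v], goodness of `v` would keep it from seeing both `p` and `q`,
          -- and by `misses-one-side` the missed one forces `v` into N[t].
          t—v : t — v
          t—v = decidable-stable (t —? v) λ t∉ → t∉ (misses t∉ (p —? t))
            where
            misses : ¬ t — v → Dec (p — t) → t — v
            misses t∉ (no ¬pt) = —-sym (misses-one-side (proj₂ Mp) px ¬pt —-refl)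
            misses t∉ (yes pt) = —-sym (misses-one-side (proj₂ Mq) qx
              (λ qt → ¬pq (—-sym (good t p q t∉ (proj₂ Mp) (—-sym pt) qt))) —-refl)

          -- If `t` misses `a`, then N[v] is contained in N[t], so by `no-larger` `t` misses `p` and
          -- `q` as well, which makes them twins and thus adjacent.
          t-sees : ∀ {a} → ¬ a — v → a — x → a — t
          t-sees {a} a∉ ax = decidable-stable (a —? t) λ ¬at →
            no-larger (misses-one-side a∉ ax ¬at) Mp
              (decidable-stable (p —? t) λ ¬pt →
                no-larger (misses-one-side a∉ ax ¬at) Mq
                  (decidable-stable (q —? t) λ ¬qt →
                    ¬pq (tw (inj₂ px) (inj₂ qx) (inj₂ px) ¬pt ¬qt —-refl)))

          -- With `t-sees`, this makes N[t] and N[x] agree outside N[v].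
          x-sees : ∀ {a} → ¬ a — v → a — t → a — x
          x-sees = x-maximal (t-sees (proj₂ Mp) px) (t-sees (proj₂ Mq) qx) t-sees

          -- Suppose `u` sees `y`. If `y` misses some `w` of N[t] outside N[v], then `w`, `t`, `v`,
          -- `y`, `u` is an induced path. Otherwise `y` sees all that `x` sees outside N[v], and
          -- maximality of `x` puts `u` into N[t].
          separated : ∀ {y u} → y — v → ¬ y — t → ¬ u — v → ¬ u — t → ¬ u — y
          separated {y} {u} yv ¬yt u∉ ¬ut uy
            with any? (λ w → ¬? (w —? v) ×-dec (w —? t) ×-dec ¬? (w —? y))
          ... | yes (w , w∉ , wt , ¬wy) =
            no-P₅ wt t—v (—-sym yv) (—-sym uy) w∉ ¬wy
              (λ wu → ¬ut (—-sym (good w u t w∉ u∉ wu (—-sym wt))))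
              (¬yt ∘ —-sym) (¬ut ∘ —-sym) (u∉ ∘ —-sym)
          ... | no none = ¬ut (t-sees u∉ (x-maximal (t⇒y (proj₂ Mp) px) (t⇒y (proj₂ Mq) qx) t⇒y u∉ uy))
            where
            t⇒y : ∀ {w} → ¬ w — v → w — x → w — y
            t⇒y {w} w∉ wx = decidable-stable (w —? y) λ ¬wy → none (w , w∉ , t-sees w∉ wx , ¬wy)

          missed-neighbours-twins : ∀ {a b} → a — v → b — v → ¬ a — t → ¬ b — t →
                                    ∀ {z} → z — a → z — b
          missed-neighbours-twins av bv ¬at ¬bt {z} za with z —? v | z —? x
          ... | yes zv | _      = tw (inj₁ av) (inj₁ bv) (inj₁ zv) ¬at ¬bt za
          ... | no _   | yes zx = tw (inj₁ av) (inj₁ bv) (inj₂ zx) ¬at ¬bt za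
          ... | no z∉  | no ¬zx = contradiction za (separated av ¬at z∉ (¬zx ∘ x-sees z∉))

          t-good : Good t
          t-good a b z ¬at ¬bt ab with a —? v | b —? v
          ... | yes av | yes bv = missed-neighbours-twins av bv ¬at ¬bt
          ... | yes av | no b∉  = contradiction (—-sym ab) (separated av ¬at b∉ ¬bt)
          ... | no a∉  | yes bv = contradiction ab (separated bv ¬bt a∉ ¬at)
          ... | no a∉  | no b∉  = good a b z a∉ b∉ ab

          -- All representatives in N[v] ∖ N[t] coincide; this one takes the place of p,
          -- and nothing takes the place of q.
          t-misses-fewer : size (missed? t) < size (missed? v)
          t-misses-fewer = injective⇒∣p∣<∣q∣ _ _ f
            (∈-comprehension⁺ (missed? v) ∘ into ∘ ∈-comprehension⁻ (missed? t))
            (λ a∈ b∈ → inj (∈-comprehension⁻ (missed? t) a∈) (∈-comprehension⁻ (missed? t) b∈))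
            (∈-comprehension⁺ (missed? v) Mq)
            (avoids ∘ ∈-comprehension⁻ (missed? t))
            where
            f : Fin n → Fin n
            f u with u —? v
            ... | yes _ = p
            ... | no _  = u

            into : ∀ {u} → Missed t u → Missed v (f u)
            into {u} (Ru , _) with u —? v
            ... | yes _ = Mp
            ... | no u∉ = Ru , u∉

            inj : ∀ {a b} → Missed t a → Missed t b → f a ≡ f b → a ≡ b
            inj {a} {b} (Ra , ¬at) (Rb , ¬bt) eq with a —? v | b —? v
            ... | yes av | yes bv = representative-unique Ra Rb λ _ →
              missed-neighbours-twins av bv ¬at ¬bt , missed-neighbours-twins bv av ¬bt ¬at
            ... | yes _ | no _ = contradiction (subst (_— t) eq (t-sees (proj₂ Mp) px)) ¬bt
            ... | no _ | yes _ = contradiction (subst (_— t) (sym eq) (t-sees (proj₂ Mp) px)) ¬at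
            ... | no _ | no _  = eq

            avoids : ∀ {u} → Missed t u → f u ≢ q
            avoids {u} (_ , ¬ut) eq with u —? v
            ... | yes _ = p≢q eq
            ... | no _  = ¬ut (subst (_— t) (sym eq) (t-sees (proj₂ Mq) qx))

          impossible : ⊥
          impossible = <⇒≱ t-misses-fewer (least t t-good)

        not-both : ∀ {x} → p — x → ¬ q — x
        not-both {x₀} px₀ qx₀ = fromMaximal (minimise {∃ λ x → p — x × q — x}
          (λ (x , _) → size (unseen? x))
          (λ _ → map′ (λ (x , px , qx , lt) → (x , px , qx) , lt)
                      (λ ((x , px , qx) , lt) → x , px , qx , lt)
                   (any? λ x → (p —? x) ×-dec (q —? x) ×-dec (_ <? _)))
          (x₀ , px₀ , qx₀))
          where
          unseen? : ∀ x → Decidable (λ u → ¬ u — v × ¬ u — x)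
          unseen? x u = ¬? (u —? v) ×-dec ¬? (u —? x)

          fromMaximal : ¬ ∃ λ (x : ∃ λ x → p — x × q — x) →
            ∀ (y : ∃ λ y → p — y × q — y) → size (unseen? (proj₁ x)) ≤ size (unseen? (proj₁ y))
          fromMaximal ((x , px , qx) , fewest) = Maximal.impossible px qx x-maximal
            (proj₂ (proj₂ (pair (λ u → (u —? v) ⊎-dec (u —? x)) (inj₁ —-refl) (inj₂ —-refl) id)))
            where
            x-maximal : ∀ {y} → p — y → q — y → (∀ {u} → ¬ u — v → u — x → u — y) →
                        ∀ {u} → ¬ u — v → u — y → u — x
            x-maximal {y} py qy x⇒y {u} u∉ uy = decidable-stable (u —? x) λ ¬ux → <⇒≱
              (size-< (unseen? y) (unseen? x) (λ (w∉ , ¬wy) → w∉ , ¬wy ∘ x⇒y w∉)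
                (u∉ , ¬ux) (λ (_ , ¬uy) → ¬uy uy))
              (fewest (y , py , qy))

      common⇒≡ : ∀ {p q x} → Missed v p → Missed v q → p — x → q — x → p ≡ q
      common⇒≡ {p} {q} Mp Mq px qx =
        decidable-stable (p ≟ q) λ p≢q → SeesTwo.not-both Mp Mq p≢q px qx

      -- Comparing the missed classes with a dominating set.

      module _ (D : Subset n) (dominator : ∀ u → ∃ λ d → d ∈ D × u — d) where

        δ : Fin n → Fin n
        δ = proj₁ ∘ dominator

        δ∈D : ∀ u → δ u ∈ D
        δ∈D = proj₁ ∘ proj₂ ∘ dominator

        u—δu : ∀ u → u — δ u
        u—δu = proj₂ ∘ proj₂ ∘ dominator

        δ-injective : ∀ {p q} → Missed v p → Missed v q → δ p ≡ δ q → p ≡ q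
        δ-injective {p} {q} Mp Mq eq =
          common⇒≡ Mp Mq (u—δu p) (subst (q —_) (sym eq) (u—δu q))

        module Onto (onto : ∀ {d} → d ∈ D → ∃ λ q → Missed v q × δ q ≡ d)
                    {d : Fin n} (d∈D : d ∈ D) (dv : d — v)
                    (d-maximal : ∀ {e} → e ∈ D → e — v →
                      (∀ {u} → u — v → u — d → u — e) → ∀ {u} → u — v → u — e → u — d)
          where

          q = proj₁ (onto d∈D)
          Mq = proj₁ (proj₂ (onto d∈D))

          qd : q — d
          qd = subst (q —_) (proj₂ (proj₂ (onto d∈D))) (u—δu q)

          -- This will contradict `no-larger`, since `d` also sees `q`. A vertex `x` of N[v] missed
          -- by `d` is seen by another `e` in `D`, which is used up by a class `r`; and `q` and `r`
          -- have no common neighbour.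
          N[v]⊆N[d] : ∀ {x} → x — v → x — d
          N[v]⊆N[d] {x} xv = decidable-stable (x —? d) refute
            where
            refute : ¬ ¬ x — d
            refute ¬xd with dominator x
            ... | e , e∈D , xe with onto e∈D
            ...   | r , Mr , δr≡e = contradictory (e —? v)
              where
              re : r — e
              re = subst (r —_) δr≡e (u—δu r)

              q≢r : q ≢ r
              q≢r q≡r = ¬xd (subst (x —_)
                (trans (sym δr≡e) (trans (cong δ (sym q≡r)) (proj₂ (proj₂ (onto d∈D))))) xe)

              ¬common : ∀ {y} → ¬ (q — y × r — y)
              ¬common (qy , ry) = q≢r (common⇒≡ Mq Mr qy ry)

              ¬qr : ¬ q — r
              ¬qr qr = ¬common (—-refl , —-sym qr)

              ¬rd : ¬ r — d
              ¬rd rd = ¬common (qd , rd)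

              ¬qe : ¬ q — e
              ¬qe qe = ¬common (qe , re)

              contradictory : Dec (e — v) → ⊥
              -- Goodness of `v` makes `x` see `r`, and `q`, `d`, `v`, `x`, `r` form an induced
              -- path.
              contradictory (no e∉) =
                no-P₅ qd dv (—-sym xv) xr (proj₂ Mq) (λ qx → ¬common (qx , —-sym xr)) ¬qr
                  (¬xd ∘ —-sym) (¬rd ∘ —-sym) (proj₂ Mr ∘ —-sym)
                where
                xr : x — r
                xr = good e r x e∉ (proj₂ Mr) (—-sym re) xe
              contradictory (yes ev)
                with any? (λ y → (y —? v) ×-dec (y —? d) ×-dec ¬? (y —? e))
              -- Here `e` sees all of N[v] that `d` sees, so by maximality `d` sees `x`.
              ... | no none = ¬xd (d-maximal e∈D ev
                (λ {u} uv ud → decidable-stable (u —? e) λ ¬ue → none (u , uv , ud , ¬ue)) xv xe)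
              -- Now `x` and `y` tell `d` and `e` apart in both directions, completing the double
              -- net. The edge between `d` and `e` is there because `q`, `d`, `v`, `e`, `r` is not
              -- an induced path.
              ... | yes (y , yv , yd , ¬ye) =
                no-double-net (—-sym dv) (—-sym ev) (—-sym qd) (—-sym re) (—-sym xv) (—-sym yv)
                  (—-sym xe) (—-sym yd) (proj₂ Mq ∘ —-sym) (proj₂ Mr ∘ —-sym) (¬rd ∘ —-sym)
                  (¬qe ∘ —-sym) (¬xd ∘ —-sym) (¬ye ∘ —-sym) ¬qr de ¬common ¬common
                where
                de : d — e
                de = decidable-stable (d —? e) λ ¬de →
                  no-P₅ qd dv (—-sym ev) (—-sym re) (proj₂ Mq) ¬qe ¬qr ¬de (¬rd ∘ —-sym)
                    (proj₂ Mr ∘ —-sym)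

          impossible : ⊥
          impossible = no-larger N[v]⊆N[d] Mq qd

        ¬onto : ¬ (∀ {d} → d ∈ D → ∃ λ q → Missed v q × δ q ≡ d)
        ¬onto onto = fromMaximal (minimise {∃ λ d → d ∈ D × d — v}
          (λ (d , _) → size (unseen? d))
          (λ _ → map′ (λ (d , d∈D , dv , lt) → (d , d∈D , dv) , lt)
                      (λ ((d , d∈D , dv) , lt) → d , d∈D , dv , lt)
                   (any? λ d → (d ∈? D) ×-dec (d —? v) ×-dec (_ <? _)))
          -- `D` meets N[v] because it dominates `v`.
          (δ v , δ∈D v , —-sym (u—δu v)))
          where
          unseen? : ∀ d → Decidable (λ u → u — v × ¬ u — d)
          unseen? d u = (u —? v) ×-dec ¬? (u —? d)

          fromMaximal : ¬ ∃ λ (d : ∃ λ d → d ∈ D × d — v) →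
            ∀ (e : ∃ λ e → e ∈ D × e — v) → size (unseen? (proj₁ d)) ≤ size (unseen? (proj₁ e))
          fromMaximal ((d , d∈D , dv) , fewest) = Onto.impossible onto d∈D dv
            λ {e} e∈D ev d⇒e {u} uv ue → decidable-stable (u —? d) λ ¬ud → <⇒≱
              (size-< (unseen? e) (unseen? d) (λ (wv , ¬we) → wv , ¬we ∘ d⇒e wv)
                (uv , ¬ud) (λ (_ , ¬ue) → ¬ue ue))
              (fewest (e , e∈D , ev))

        -- `δ` embeds the missed classes into `D`, and by `¬onto` some vertex of `D` is left over.
        missed<∣D∣ : size (missed? v) < ∣ D ∣
        missed<∣D∣ with any? (λ d → (d ∈? D) ×-dec
                               ¬? (any? λ q → missed? v q ×-dec (δ q ≟ d)))
        ... | yes (d , d∈D , none) = injective⇒∣p∣<∣q∣ _ _ δ (λ _ → δ∈D _)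
          (λ p∈ q∈ → δ-injective (∈-comprehension⁻ (missed? v) p∈) (∈-comprehension⁻ (missed? v) q∈))
          d∈D (λ q∈ eq → none (_ , ∈-comprehension⁻ (missed? v) q∈ , eq))
        ... | no all-hit = contradiction
          (λ {d} d∈D → decidable-stable (any? λ q → missed? v q ×-dec (δ q ≟ d)) λ none →
            all-hit (d , d∈D , none))
          ¬onto

    missed<dominating : Fin n → ∃ λ v → ∀ D → (∀ u → ∃ λ d → d ∈ D × u — d) →
                        size (missed? v) < ∣ D ∣
    missed<dominating u = fromLeast (minimise {∃ Good} (λ (v , _) → size (missed? v))
      (λ _ → map′ (λ (v , good , lt) → (v , good) , lt) (λ ((v , good) , lt) → v , good , lt)
               (any? λ v → good? v ×-dec (_ <? _)))
      (good-exists (cliquesBeyond-exists {U} (λ _ → yes tt) (u , tt))))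
      where
      good-exists : (∃ λ v → U v × CliquesBeyond U v) → ∃ Good
      good-exists (v , _ , cliques) = v , λ _ _ _ → cliques tt tt tt

      fromLeast : (∃ λ (v : ∃ Good) → ∀ (w : ∃ Good) →
                   size (missed? (proj₁ v)) ≤ size (missed? (proj₁ w))) → _
      fromLeast ((v , good) , least) =
        v , LeastMissed.missed<∣D∣ good λ w w-good → least (w , w-good)

-- Bounds in the domination game.

module _ {n : ℕ} (G : Graph n) where

  private
    infix 4 _—_
    _—_ : Rel (Fin n) 0ℓ
    u — v = _∈N[_] G u v

  —-refl : ∀ {u} → u — u
  —-refl = inj₁ refl

  —-sym : ∀ {u v} → u — v → v — u
  —-sym (inj₁ eq)  = inj₁ (sym eq)
  —-sym (inj₂ adj) = inj₂ (Graph.~-sym G adj)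

  _—?_ : Binary.Decidable _—_
  u —? v = (u ≟ v) ⊎-dec Graph._~?_ G v u

  open ClosedNeighbourhoods _—_ _—?_ —-refl —-sym public

  dominatedBy-∪⁻ : ∀ {S u v} → DominatedBy G (S ∪ ⁅ v ⁆) u → DominatedBy G S u ⊎ u — v
  dominatedBy-∪⁻ {S} {u} {v} (w , w∈ , uw) with x∈p∪q⁻ S ⁅ v ⁆ w∈
  ... | inj₁ w∈S = inj₁ (w , w∈S , uw)
  ... | inj₂ w∈v = inj₂ (subst (u —_) (x∈⁅y⁆⇒x≡y v w∈v) uw)

  dominatedBy-∪⁺ˡ : ∀ {S u v} → DominatedBy G S u → DominatedBy G (S ∪ ⁅ v ⁆) u
  dominatedBy-∪⁺ˡ (w , w∈S , uw) = w , x∈p∪q⁺ (inj₁ w∈S) , uw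

  dominatedBy-∪⁺ʳ : ∀ {S u v} → u — v → DominatedBy G (S ∪ ⁅ v ⁆) u
  dominatedBy-∪⁺ʳ {v = v} uv = v , x∈p∪q⁺ (inj₂ (x∈⁅x⁆ v)) , uv

  ¬dominatedBy-⊥ : ∀ {u} → ¬ DominatedBy G ∅ u
  ¬dominatedBy-⊥ (_ , v∈⊥ , _) = ∉⊥ v∈⊥

  legal-at-start : ∀ v → Legal G ∅ v
  legal-at-start v = v , —-refl , ¬dominatedBy-⊥

  undominatedRepresentative? : ∀ S → Decidable (λ u → Representative u × ¬ DominatedBy G S u)
  undominatedRepresentative? S u = representative? u ×-dec ¬? (dominatedBy? G S u)

  -- Every legal move dominates a representative for the first time.
  gameValue-bound : ∀ {p S k} → GameValue G p S k → k ≤ size (undominatedRepresentative? S)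
  gameValue-bound (over _) = z≤n
  gameValue-bound {S = S} (move f fv v lv@(u , uv , u∉) _) with representative-exists u
  ... | r , Rr , r~u = ≤-<-trans (gameValue-bound (fv v lv))
    (size-< (undominatedRepresentative? (S ∪ ⁅ v ⁆)) (undominatedRepresentative? S)
      (λ (Rx , x∉) → Rx , x∉ ∘ dominatedBy-∪⁺ˡ)
      (Rr , λ (w , w∈S , rw) → u∉ (w , w∈S , —-sym (proj₁ (r~u w) (—-sym rw))))
      (λ (_ , r∉) → r∉ (dominatedBy-∪⁺ʳ (—-sym (proj₂ (r~u v) (—-sym uv))))))

  γg-bound : ∀ v → γg G ≤ suc (size (missed? v))
  γg-bound v = afterFirstMove (γg-correct G)
    where
    afterFirstMove : ∀ {k} → GameValue G dominator ∅ k → k ≤ suc (size (missed? v))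
    afterFirstMove (over ¬legal) = contradiction (legal-at-start v) (¬legal v)
    afterFirstMove (move f fv _ _ best) = s≤s (≤-trans (best v (legal-at-start v))
      (≤-trans (gameValue-bound (fv v (legal-at-start v)))
        (injective⇒∣p∣≤∣q∣ _ _ id
          (∈-comprehension⁺ (missed? v) ∘
            (λ (Ru , u∉) → Ru , u∉ ∘ dominatedBy-∪⁺ʳ) ∘
            ∈-comprehension⁻ (undominatedRepresentative? (∅ ∪ ⁅ v ⁆)))
          λ _ _ eq → eq)))

  pairCondition⇒γg≤γ : .{{NonZero n}} → PairCondition → γg G ≤ γ G
  pairCondition⇒γg≤γ pair = bound (γ-correct G) (missed<dominating pair (someVertex n))
    where
    someVertex : ∀ n → .{{NonZero n}} → Fin n
    someVertex (suc _) = zero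

    bound : ∀ {k} → IsDominationNumber G k →
            (∃ λ v → ∀ D → Dominating G D → size (missed? v) < ∣ D ∣) → γg G ≤ k
    bound ((D , dominating , refl) , _) (v , v-best) =
      ≤-trans (γg-bound v) (v-best D dominating)

  dominatingPair⇒γ≤2 : ∀ a b → (∀ u → u — a ⊎ u — b) → γ G ≤ 2
  dominatingPair⇒γ≤2 a b dom = ≤-trans (proj₂ (γ-correct G) (⁅ a ⁆ ∪ ⁅ b ⁆) dominating)
    (injective⇒∣p∣≤∣q∣ (⁅ a ⁆ ∪ ⁅ b ⁆) (⊤ {2}) f (λ _ → ∈⊤) inj)
    where
    dominating : Dominating G (⁅ a ⁆ ∪ ⁅ b ⁆)
    dominating u with dom u
    ... | inj₁ ua = a , x∈p∪q⁺ (inj₁ (x∈⁅x⁆ a)) , ua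
    ... | inj₂ ub = b , x∈p∪q⁺ (inj₂ (x∈⁅x⁆ b)) , ub

    f : Fin n → Fin 2
    f u with u ≟ a
    ... | yes _ = 0F
    ... | no _  = 1F

    b-only : ∀ {u} → u ∈ ⁅ a ⁆ ∪ ⁅ b ⁆ → u ≢ a → u ≡ b
    b-only u∈ u≢a with x∈p∪q⁻ ⁅ a ⁆ ⁅ b ⁆ u∈
    ... | inj₁ u∈a = contradiction (x∈⁅y⁆⇒x≡y a u∈a) u≢a
    ... | inj₂ u∈b = x∈⁅y⁆⇒x≡y b u∈b

    inj : ∀ {x y} → x ∈ ⁅ a ⁆ ∪ ⁅ b ⁆ → y ∈ ⁅ a ⁆ ∪ ⁅ b ⁆ → f x ≡ f y → x ≡ y
    inj {x} {y} x∈ y∈ eq with x ≟ a | y ≟ a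
    ... | yes x≡a | yes y≡a = trans x≡a (sym y≡a)
    ... | no x≢a  | no y≢a  = trans (b-only x∈ x≢a) (sym (b-only y∈ y≢a))
    inj x∈ y∈ () | yes _ | no _
    inj x∈ y∈ () | no _  | yes _

  ∣D∣<2⇒universal : ∀ D → Dominating G D → ∣ D ∣ < 2 → Fin n → ∃ λ d → ∀ u → u — d
  ∣D∣<2⇒universal D dominating ∣D∣<2 w = universal (dominating w)
    where
    universal : DominatedBy G D w → ∃ λ d → ∀ u → u — d
    universal (d , d∈D , _) = d , λ u → same (dominating u)
      where
      same : ∀ {u} → DominatedBy G D u → u — d
      same {u} (e , e∈D , ue) = subst (u —_)
        (decidable-stable (e ≟ d) λ e≢d → <⇒≱ ∣D∣<2
          (≤-<-trans (≤-<-trans z≤n (x∈p⇒∣p-x∣<∣p∣ (x∈p∧x≢y⇒x∈p-y e∈D e≢d)))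
            (x∈p⇒∣p-x∣<∣p∣ d∈D)))
        ue

  γ<2⇒universal : γ G < 2 → Fin n → ∃ λ d → ∀ u → u — d
  γ<2⇒universal = fromMinimum (γ-correct G)
    where
    fromMinimum : ∀ {k} → IsDominationNumber G k → k < 2 → Fin n → ∃ λ d → ∀ u → u — d
    fromMinimum ((D , dominating , refl) , _) = ∣D∣<2⇒universal D dominating

  -- A move `z` dominating `x` is legal, and with at most one move left it must finish the game, so
  -- it dominates `y` as well.
  staller-ends⇒twins : ∀ {S k} → GameValue G staller S k → k ≤ 1 →
    ∀ {x y z} → ¬ DominatedBy G S x → ¬ DominatedBy G S y → z — x → z — y
  staller-ends⇒twins (over ¬legal) _ {x} {z = z} x∉ y∉ zx =
    contradiction (x , —-sym zx , x∉) (¬legal z)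
  staller-ends⇒twins {S} (move g gv w _ best) (s≤s gw≤0) {x} {y} {z} x∉ y∉ zx =
    finished (gv z z-legal) (≤-trans (best z z-legal) gw≤0)
    where
    z-legal : Legal G S z
    z-legal = x , —-sym zx , x∉

    finished : ∀ {k} → GameValue G dominator (S ∪ ⁅ z ⁆) k → k ≤ 0 → z — y
    finished (over ¬legal) _ with dominatedBy-∪⁻ {S} (decidable-stable
      (dominatedBy? G (S ∪ ⁅ z ⁆) y) λ ¬dom → ¬legal y (y , —-refl , ¬dom))
    ... | inj₁ y∈ = contradiction y∈ y∉
    ... | inj₂ yz = —-sym yz

  γg≤2⇒twins : Fin n → γg G ≤ 2 →
    ∃ λ v → ∀ {x y z} → ¬ x — v → ¬ y — v → z — x → z — y
  γg≤2⇒twins u = afterFirstMove (γg-correct G)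
    where
    afterFirstMove : ∀ {k} → GameValue G dominator ∅ k → k ≤ 2 →
      ∃ λ v → ∀ {x y z} → ¬ x — v → ¬ y — v → z — x → z — y
    afterFirstMove (over ¬legal) _ = contradiction (legal-at-start u) (¬legal u)
    afterFirstMove (move f fv v lv _) (s≤s fv≤1) = v , λ x∉ y∉ →
      staller-ends⇒twins (fv v lv) fv≤1 (undominated x∉) (undominated y∉)
      where
      undominated : ∀ {x} → ¬ x — v → ¬ DominatedBy G (∅ ∪ ⁅ v ⁆) x
      undominated x∉ dom with dominatedBy-∪⁻ {∅} dom
      ... | inj₁ bad = ¬dominatedBy-⊥ bad
      ... | inj₂ xv  = x∉ xv

-- From minimal imperfection to the pair condition.

enumerate : ∀ {n} (p : Subset n) → Fin ∣ p ∣ → Fin n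
enumerate (outside ∷ p) i       = suc (enumerate p i)
enumerate (inside ∷ p)  zero    = zero
enumerate (inside ∷ p)  (suc i) = suc (enumerate p i)

enumerate-injective : ∀ {n} (p : Subset n) {i j} → enumerate p i ≡ enumerate p j → i ≡ j
enumerate-injective (outside ∷ p) eq = enumerate-injective p (suc-injective eq)
enumerate-injective (inside ∷ p) {zero}  {zero}  _  = refl
enumerate-injective (inside ∷ p) {suc _} {suc _} eq =
  cong suc (enumerate-injective p (suc-injective eq))

enumerate-∈ : ∀ {n} (p : Subset n) i → enumerate p i ∈ p
enumerate-∈ (outside ∷ p) i       = there (enumerate-∈ p i)
enumerate-∈ (inside ∷ p)  zero    = here
enumerate-∈ (inside ∷ p)  (suc i) = there (enumerate-∈ p i)

enumerate-surjective : ∀ {n} (p : Subset n) {u} → u ∈ p → ∃ λ i → enumerate p i ≡ u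
enumerate-surjective (outside ∷ p) (there u∈) with enumerate-surjective p u∈
... | i , eq = i , cong suc eq
enumerate-surjective (inside ∷ p) here = zero , refl
enumerate-surjective (inside ∷ p) (there u∈) with enumerate-surjective p u∈
... | i , eq = suc i , cong suc eq

-- If `P` is the whole vertex set, γ(G) ≤ 2 and γ(G) ≠ 2 give a universal vertex, which misses
-- nothing. Otherwise `P` induces a proper subgraph, where γ_g = γ ≤ 2, and an optimal first move of
-- Dominator is the vertex sought.
minimallyImperfect⇒pairCondition : ∀ {n} (G : Graph n) →
  MinimallyImperfect G → γ G ≢ 2 → PairCondition G
minimallyImperfect⇒pairCondition {n} G (perfect , _) γ≢2 {P} P? {a} {b} Pa Pb dom
  with any? (¬? ∘ P?)
... | no none = d , all-P d , λ {x} _ _ _ x∉ → contradiction (d-universal x) x∉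
  where
  all-P : ∀ u → P u
  all-P u = decidable-stable (P? u) λ ¬Pu → none (u , ¬Pu)

  universal = γ<2⇒universal G
    (ℕ.≤∧≢⇒< (dominatingPair⇒γ≤2 G a b λ u → dom (all-P u)) γ≢2) a
  d = proj₁ universal
  d-universal = proj₂ universal
... | yes (w , ¬Pw) =
  e v , enumerate∈P v , λ Px Py Pz → transfer (index Px) (index Py) (index Pz)
  where
  S = comprehension P?

  e : Fin ∣ S ∣ → Fin n
  e = enumerate S

  enumerate∈P : ∀ i → P (e i)
  enumerate∈P i = ∈-comprehension⁻ P? (enumerate-∈ S i)

  index : ∀ {u} → P u → ∃ λ i → e i ≡ u
  index Pu = enumerate-surjective S (∈-comprehension⁺ P? Pu)

  F : Graph ∣ S ∣
  -- Minimality makes the proper subgraph perfect, which is a statement about its own induced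
  -- subgraphs; the identity embedding picks the subgraph itself.
  F = induced (induced G (mk↣ (enumerate-injective S))) (mk↣ id)

  toF : ∀ {i j} → _∈N[_] G (e i) (e j) → _∈N[_] F i j
  toF (inj₁ eq)  = inj₁ (enumerate-injective S eq)
  toF (inj₂ adj) = inj₂ adj

  fromF : ∀ {i j} → _∈N[_] F i j → _∈N[_] G (e i) (e j)
  fromF (inj₁ eq)  = inj₁ (cong e eq)
  fromF (inj₂ adj) = inj₂ adj

  i₀ = proj₁ (index Pa)
  j₀ = proj₁ (index Pb)

  dominated : ∀ i → _∈N[_] F i i₀ ⊎ _∈N[_] F i j₀
  dominated i with dom (enumerate∈P i)
  ... | inj₁ ia = inj₁ (toF (subst (_∈N[_] G (e i)) (sym (proj₂ (index Pa))) ia))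
  ... | inj₂ ib = inj₂ (toF (subst (_∈N[_] G (e i)) (sym (proj₂ (index Pb))) ib))

  nonZero : ∀ {k} → Fin k → NonZero k
  nonZero {suc _} _ = _

  proper : ∣ S ∣ < n
  proper = subst (∣ S ∣ <_) (∣⊤∣≡n n) (injective⇒∣p∣<∣q∣ S ⊤ id (λ _ → ∈⊤) (λ _ _ eq → eq)
    (∈⊤ {x = w}) λ { w∈S refl → ¬Pw (∈-comprehension⁻ P? w∈S) })

  γg≡γ : γg F ≡ γ F
  γg≡γ = perfect _ {{nonZero i₀}} (mk↣ (enumerate-injective S)) proper _ {{nonZero i₀}} (mk↣ id)

  twins = γg≤2⇒twins F i₀ (subst (_≤ 2) (sym γg≡γ) (dominatingPair⇒γ≤2 F i₀ j₀ dominated))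
  v = proj₁ twins

  transfer : ∀ {x y z} → ∃ (λ i → e i ≡ x) → ∃ (λ i → e i ≡ y) → ∃ (λ i → e i ≡ z) →
             ¬ _∈N[_] G x (e v) → ¬ _∈N[_] G y (e v) → _∈N[_] G z x → _∈N[_] G z y
  transfer (_ , refl) (_ , refl) (_ , refl) x∉ y∉ zx =
    fromF (proj₂ twins (x∉ ∘ fromF) (y∉ ∘ fromF) (toF zx))

theorem3p8 : (n : ℕ) → .{{_ : NonZero n}} → (G : Graph n) →
    MinimallyImperfect G → γ G ≡ 2
theorem3p8 n G imperfect@(_ , γ<γg) = decidable-stable (γ G ℕ.≟ 2) λ γ≢2 →
  <⇒≱ γ<γg (pairCondition⇒γg≤γ G (minimallyImperfect⇒pairCondition G imperfect γ≢2))
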